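{- Let $G$ be a finite, simple, connected graph with vertex cover number $\mathsf{vcn}$, and let $\mathsf{c}(G)$ be its cop number. Then $\mathsf{c}(G) \leq \left\lceil \frac{\mathsf{vcn}}{3}\right\rceil + 1$.
   Context: Cops and Robber game: two players with perfect information play on a graph $G$. The cop player places each of $k$ cops on a vertex (several cops may share a vertex); then the robber player places one robber on a vertex. Then they alternate moves, cops first. In a cop move, each cop either moves to an adjacent vertex or stays; in a robber move, the robber either moves to an adjacent vertex or stays. The cops win if they have a strategy to capture the robber (some cop occupies the same vertex as the robber) in finitely many moves; the robber wins if it can evade capture forever. $G$ is $k$-copwin if $k$ cops have a winning strategy; the cop number $\mathsf{c}(G)$ is the minimum such $k$. The vertex cover number of $G$ is the minimum size of a set $U\subseteq V(G)$ such that $V(G)\setminus U$ is independent. -}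

module Defs where

open import Data.Fin using (Fin)
open import Data.Fin.Subset using (Subset; _∈_; ∁; ∣_∣)
open import Data.List using (List; []; _∷_)
open import Data.Nat using (ℕ; zero; suc; _+_; _≤_; _/_)
open import Data.Product using (_×_; ∃-syntax)
open import Data.Sum using (_⊎_)
open import Level using (0ℓ)
open import Relation.Binary using (Rel; Decidable; Symmetric)
open import Relation.Binary.Construct.Closure.ReflexiveTransitive using (Star)
open import Relation.Binary.PropositionalEquality using (_≡_)
open import Relation.Nullary using (¬_)

-- Adjacency in a finite graph is explicit data, hence decidable.
record SimpleGraph (n : ℕ) : Set₁ where
  field
    Adj    : Rel (Fin n) 0ℓ
    adj?   : Decidable Adj
    sym    : Symmetric Adj
    irrefl : ∀ v → ¬ Adj v v

IsLeast : (ℕ → Set) → ℕ → Set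
IsLeast P m = P m × (∀ k → P k → m ≤ k)

⌈_/3⌉ : ℕ → ℕ
⌈ m /3⌉ = (m + 2) / 3

module _ {n : ℕ} (G : SimpleGraph n) where
  open SimpleGraph G

  -- This also admits the graph with no vertices.
  Connected : Set
  Connected = ∀ u v → Star Adj u v

  Independent : Subset n → Set
  Independent S = ∀ u v → u ∈ S → v ∈ S → ¬ Adj u v

  IsVertexCover : Subset n → Set
  IsVertexCover U = Independent (∁ U)

  IsVertexCoverNumber : ℕ → Set
  IsVertexCoverNumber = IsLeast λ s → ∃[ U ] (IsVertexCover U × ∣ U ∣ ≡ s)

  Step : Rel (Fin n) 0ℓ
  Step u v = u ≡ v ⊎ Adj u v

  Cops : ℕ → Set
  Cops k = Fin k → Fin n

  -- The argument of `cops` lists the robber's positions so far, most recent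
  -- first; the result is where the cops stand after answering the most recent
  -- one, so `cops []` is their initial placement. The cops' own past positions
  -- are determined by this list, so no generality is lost by omitting them.
  record Strategy (k : ℕ) : Set where
    field
      cops  : List (Fin n) → Cops k
      legal : ∀ r h i → Step (cops h i) (cops (r ∷ h) i)

  -- ρ 0 is the robber's placement and ρ t its position after t moves. Since the
  -- robber may always stay put, infinite sequences account for all plays.
  record RobberPlay : Set where
    field
      ρ     : ℕ → Fin n
      legal : ∀ t → Step (ρ t) (ρ (suc t))

    -- ρ (t - 1) , … , ρ 0
    history : ℕ → List (Fin n)
    history zero    = []
    history (suc t) = ρ t ∷ history t

  -- Capture can occur when the robber arrives at ρ t, or when the cops answer.
  CapturedAt : ∀ {k} → Strategy k → RobberPlay → ℕ → Set
  CapturedAt σ play t =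
    ∃[ i ] (cops (history t) i ≡ ρ t ⊎ cops (history (suc t)) i ≡ ρ t)
    where
    open Strategy σ using (cops)
    open RobberPlay play using (ρ; history)

  Winning : ∀ {k} → Strategy k → Set
  Winning σ = ∀ play → ∃[ t ] CapturedAt σ play t

  CopWin : ℕ → Set
  CopWin k = ∃[ σ ] Winning {k} σ

  IsCopNumber : ℕ → Set
  IsCopNumber = IsLeast CopWin

{-# OPTIONS --safe #-}
-- Let W be the part of the vertex cover U not yet protected. A single cop can protect
-- three vertices of W for good, either by sitting on a vertex v with three of them in N[v],
-- or by shadowing the robber on a shortest path of length 3 or 4 between vertices of W,
-- which contains a third one. If neither is possible, every closed neighbourhood meets W
-- at most twice, and any two vertices of W in the robber's component are at distance at
-- most 2; then two cops win from any vertex u of W there: one chases the robber while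
-- the other moves next to the only other vertex of W to which the robber can escape.
module Submission where

open import Defs
open import Data.Fin using (Fin; zero; suc; _≟_)
open import Data.Fin.Properties using (any?)
open import Data.Fin.Subset using (Subset; _∈_; _∉_; ∣_∣; _-_)
open import Data.Fin.Subset.Properties
  using (_∈?_; x∉p⇒x∈∁p; x∈p∧x≢y⇒x∈p-y; x∈p⇒∣p-x∣<∣p∣)
open import Data.List using (List; []; _∷_)
open import Data.Maybe using (Maybe; just; nothing)
open import Data.Nat
  using (ℕ; zero; suc; _+_; _*_; _≤_; _<_; _≤′_; ≤′-refl; ≤′-step; z≤n; s≤s; s≤s⁻¹; _%_)
open import Data.Nat.DivMod using (m≡m%n+[m/n]*n; m%n<n)
open import Data.Nat.Properties hiding (_≟_)
open import Data.Product using (_×_; _,_; ∃-syntax; proj₁; proj₂)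
open import Data.Sum using (_⊎_; inj₁; inj₂)
open import Data.Vec.Functional using (updateAt; tail) renaming (_∷_ to _◂_)
open import Data.Vec.Functional.Properties using (updateAt-updates; updateAt-minimal)
open import Function using (const; _∘_; id)
open import Relation.Binary.Construct.Closure.ReflexiveTransitive using (Star; ε; _◅_)
open import Relation.Binary.Definitions using (tri<; tri≈; tri>)
open import Relation.Binary.PropositionalEquality
  using (_≡_; _≢_; refl; sym; trans; cong; subst; subst₂)
open import Relation.Nullary using (¬_; Dec; yes; no; contradiction)
open import Relation.Nullary.Decidable using (_×-dec_; _⊎-dec_; _→-dec_; ¬?)

module _ {n : ℕ} (G : SimpleGraph n) where
  open SimpleGraph G using (Adj; adj?) renaming (sym to adj-sym)

  step? : ∀ u v → Dec (Step G u v)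
  step? u v = (u ≟ v) ⊎-dec adj? u v

  step-sym : ∀ {u v} → Step G u v → Step G v u
  step-sym (inj₁ eq)  = inj₁ (sym eq)
  step-sym (inj₂ adj) = inj₂ (adj-sym adj)

  step-updateAt : ∀ {k} (c : Cops G k) i {v} → Step G (c i) v →
                  ∀ j → Step G (c j) (updateAt c i (const v) j)
  step-updateAt c i s j with j ≟ i
  ... | yes refl = subst (Step G (c i)) (sym (updateAt-updates i c)) s
  ... | no  j≢i  = inj₁ (sym (updateAt-minimal j i c j≢i))

  -- The game with part of the cover already protected.

  module CoverGame (U : Subset n) (cover : IsVertexCover G U) where

    -- Guards protect U ∖ W; the robber is confined to the remaining vertices.
    Free : Subset n → Fin n → Set
    Free W v = v ∈ U → v ∈ W

    free? : ∀ W v → Dec (Free W v)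
    free? W v = (v ∈? U) →-dec (v ∈? W)

    -- An endpoint in `U` that is free lies in `W`, so `W` covers every edge the robber can still
    -- use. All later restrictions on the robber's moves come from this.
    edge-covered : ∀ {W u v} → Free W u → Free W v → Adj u v → u ∈ W ⊎ v ∈ W
    edge-covered {u = u} {v} fu fv adj with u ∈? U | v ∈? U
    ... | yes u∈U | _       = inj₁ (fu u∈U)
    ... | no  _   | yes v∈U = inj₂ (fv v∈U)
    ... | no u∉U  | no v∉U  =
      contradiction adj (cover u v (x∉p⇒x∈∁p u∉U) (x∉p⇒x∈∁p v∉U))

    -- Won positions with the cops to move, the robber losing if it leaves Free W.
    data Win (W : Subset n) {k} (c : Cops G k) (r : Fin n) : Set where
      move : ∀ c′ → (∀ i → Step G (c i) (c′ i)) →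
             (∃[ i ] c′ i ≡ r) ⊎ (∀ r′ → Step G r r′ → Free W r′ → Win W c′ r′) →
             Win W c r

    capture : ∀ {W k} (c : Cops G k) i {r} → Step G (c i) r → Win W c r
    capture c i s =
      move (updateAt c i (const _)) (step-updateAt c i s) (inj₁ (i , updateAt-updates i c))

    advance : ∀ {W k} (c : Cops G k) i {v r} → Step G (c i) v →
              (∀ c′ → c′ i ≡ v → (∀ j → j ≢ i → c′ j ≡ c j) →
               ∀ r′ → Step G r r′ → Free W r′ → Win W c′ r′) →
              Win W c r
    advance c i s win =
      move (updateAt c i (const _)) (step-updateAt c i s)
        (inj₂ (win _ (updateAt-updates i c) λ j → updateAt-minimal j i c))

    -- Brings cop `i` into position while the others wait. The robber moves meanwhile, so only what
    -- is preserved by its moves, namely `I`, is known of it on arrival.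
    walk : ∀ {W k} {I : Fin n → Set} →
           (∀ {r r′} → I r → Step G r r′ → Free W r′ → I r′) →
           ∀ i {a v} → Star Adj a v → (c : Cops G k) → c i ≡ a → ∀ {r} → I r →
           (∀ c′ → c′ i ≡ v → (∀ j → j ≢ i → c′ j ≡ c j) → ∀ r′ → I r′ → Win W c′ r′) →
           Win W c r
    walk inv i ε          c refl I win = win c refl (λ _ _ → refl) _ I
    walk inv i (adj ◅ as) c refl I win =
      advance c i (inj₂ adj) λ c₁ at₁ same₁ r₁ s₁ f₁ →
        walk inv i as c₁ at₁ (inv I s₁ f₁) λ c₂ at₂ same₂ →
          win c₂ at₂ λ j j≢i → trans (same₂ j j≢i) (same₁ j j≢i)

    -- Guards and the cops they leave over.

    record Guard (W W′ : Subset n) : Set where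
      field
        shadow : Fin n → Fin n
        follow : ∀ {r r′} → Free W r → Free W r′ → Step G r r′ → Step G (shadow r) (shadow r′)
        -- The guarding cop still stands on the shadow of the old position when the robber arrives
        -- at `r′`.
        catch  : ∀ {r r′} → Free W r → Free W r′ → Step G r r′ →
                 Free W′ r′ ⊎ Step G (shadow r) r′

    module _ {W W′ : Subset n} (guard : Guard W W′) where
      open Guard guard

      -- The other cops follow their win for `W′`, on which the recursion runs, while cop `zero`
      -- shadows. Their win is silent only about a robber leaving `Free W′`, and such a robber is
      -- caught by the guard at once.
      pursue : ∀ {k} (c : Cops G (suc k)) {r} → Free W r → Step G (c zero) (shadow r) →
               Win W′ (tail c) r → Win W c r
      pursue c {r} f s (move d legal end) =
        move (shadow r ◂ d) (λ { zero → s ; (suc i) → legal i }) (outcome end)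
        where
        outcome : (∃[ i ] d i ≡ r) ⊎ (∀ r′ → Step G r r′ → Free W′ r′ → Win W′ d r′) →
                  (∃[ i ] (shadow r ◂ d) i ≡ r) ⊎
                  (∀ r′ → Step G r r′ → Free W r′ → Win W (shadow r ◂ d) r′)
        outcome (inj₁ (i , eq)) = inj₁ (suc i , eq)
        outcome (inj₂ win)      = inj₂ λ r′ s′ f′ → continue r′ s′ f′ (catch f f′ s′)
          where
          continue : ∀ r′ → Step G r r′ → Free W r′ → Free W′ r′ ⊎ Step G (shadow r) r′ →
                     Win W (shadow r ◂ d) r′
          continue r′ s′ f′ (inj₁ f″) = pursue _ f′ (follow f f′ s′) (win r′ s′ f″)
          continue r′ s′ f′ (inj₂ s″) = capture _ zero s″

    -- The cops may start anywhere, so the induction hypothesis applies to whatever position is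
    -- present once a guard is in place.
    Wins : ℕ → Subset n → Set
    Wins k W = ∀ (c : Cops G k) r → Free W r → Win W c r

    -- Protecting three vertices with one cop.

    Triple : Subset n → (x y z : Fin n) → Set
    Triple W x y z = (x ∈ W × y ∈ W × z ∈ W) × (x ≢ y × x ≢ z × y ≢ z)

    triple? : ∀ W x y z → Dec (Triple W x y z)
    triple? W x y z =
      (x ∈? W ×-dec y ∈? W ×-dec z ∈? W) ×-dec
      (¬? (x ≟ y) ×-dec ¬? (x ≟ z) ×-dec ¬? (y ≟ z))

    ∣remove-triple∣ : ∀ {W x y z} → Triple W x y z → 3 + ∣ W - x - y - z ∣ ≤ ∣ W ∣
    ∣remove-triple∣ ((x∈ , y∈ , z∈) , (x≢y , x≢z , y≢z)) =
      ≤-trans (s≤s (s≤s (x∈p⇒∣p-x∣<∣p∣ z∈W-x-y)))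
        (≤-trans (s≤s (x∈p⇒∣p-x∣<∣p∣ y∈W-x)) (x∈p⇒∣p-x∣<∣p∣ x∈))
      where
      y∈W-x = x∈p∧x≢y⇒x∈p-y y∈ (x≢y ∘ sym)
      z∈W-x-y = x∈p∧x≢y⇒x∈p-y (x∈p∧x≢y⇒x∈p-y z∈ (x≢z ∘ sym)) (y≢z ∘ sym)

    free-remove : ∀ {W} x y z {r} → Free W r →
                  Free (W - x - y - z) r ⊎ (r ≡ x ⊎ r ≡ y ⊎ r ≡ z)
    free-remove x y z {r} f with r ≟ x | r ≟ y | r ≟ z
    ... | yes eq | _      | _      = inj₂ (inj₁ eq)
    ... | no _   | yes eq | _      = inj₂ (inj₂ (inj₁ eq))
    ... | no _   | no _   | yes eq = inj₂ (inj₂ (inj₂ eq))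
    ... | no ≢x  | no ≢y  | no ≢z  =
      inj₁ λ r∈U → x∈p∧x≢y⇒x∈p-y (x∈p∧x≢y⇒x∈p-y (x∈p∧x≢y⇒x∈p-y (f r∈U) ≢x) ≢y) ≢z

    -- Phrased as the effect on `Wins` rather than as the existence of a `Guard`, so that it
    -- includes the moves that bring the cop to its shadow.
    Guardable : Subset n → Set
    Guardable W = ∃[ x ] ∃[ y ] ∃[ z ] Triple W x y z ×
                  (∀ {k} → Wins k (W - x - y - z) → Wins (suc k) W)

    guard-neighbours : Connected G → ∀ {W v x y z} → Triple W x y z →
                       Step G v x → Step G v y → Step G v z → Guardable W
    guard-neighbours conn {W} {v} {x} {y} {z} triple vx vy vz =
      x , y , z , triple , λ wins c r f →
        walk {I = Free W} (λ _ _ f′ → f′) zero (conn (c zero) v) c refl f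
          λ c′ at _ r′ f′ → finish wins c′ at f′ (near f′)
      where
      near : ∀ {r} → Free W r → Free (W - x - y - z) r ⊎ Step G v r
      near f with free-remove x y z f
      ... | inj₁ f′                 = inj₁ f′
      ... | inj₂ (inj₁ refl)        = inj₂ vx
      ... | inj₂ (inj₂ (inj₁ refl)) = inj₂ vy
      ... | inj₂ (inj₂ (inj₂ refl)) = inj₂ vz

      guard : Guard W (W - x - y - z)
      guard = record
        { shadow = const v
        ; follow = λ _ _ _ → inj₁ refl
        ; catch  = λ _ f′ _ → near f′
        }

      finish : ∀ {k} → Wins k (W - x - y - z) → ∀ (c : Cops G (suc k)) {r} → c zero ≡ v →
               Free W r → Free (W - x - y - z) r ⊎ Step G v r → Win W c r
      finish wins c refl f (inj₁ f′) = pursue guard c f (inj₁ refl) (wins (tail c) _ f′)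
      -- The robber may already be on one of the three vertices when the cop arrives.
      finish wins c refl f (inj₂ s)  = capture c zero s

    -- Distances and shortest paths among the free vertices.

    Reach : Subset n → ℕ → Fin n → Fin n → Set
    Reach W zero    u v = u ≡ v
    Reach W (suc m) u v = ∃[ w ] Free W w × Step G u w × Reach W m w v

    reach? : ∀ W m u v → Dec (Reach W m u v)
    reach? W zero    u v = u ≟ v
    reach? W (suc m) u v = any? λ w → free? W w ×-dec step? u w ×-dec reach? W m w v

    reach-snoc : ∀ {W} m {u v w} → Reach W m u v → Step G v w → Free W w → Reach W (suc m) u w
    reach-snoc zero    refl              s fw = _ , fw , s , refl
    reach-snoc (suc m) (x , fx , s′ , p) s fw = x , fx , s′ , reach-snoc m p s fw

    reach-weaken : ∀ {W m u v} → Free W u → Reach W m u v → Reach W (suc m) u v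
    reach-weaken fu p = _ , fu , inj₁ refl , p

    reach-mono : ∀ {W l m u v} → Free W u → l ≤ m → Reach W l u v → Reach W m u v
    reach-mono {W} {l} {u = u} {v} fu l≤m p = go (≤⇒≤′ l≤m)
      where
      go : ∀ {m} → l ≤′ m → Reach W m u v
      go ≤′-refl       = p
      go (≤′-step l≤m) = reach-weaken fu (go l≤m)

    -- The distance from u inside Free W, truncated at m.
    height : Subset n → Fin n → ℕ → Fin n → ℕ
    height W u zero    r = zero
    height W u (suc m) r with reach? W m u r
    ... | yes _ = height W u m r
    ... | no  _ = suc m

    height-≤ : ∀ {W u} m r → height W u m r ≤ m
    height-≤ zero r = z≤n
    height-≤ {W} {u} (suc m) r with reach? W m u r
    ... | yes _ = m≤n⇒m≤1+n (height-≤ m r)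
    ... | no  _ = ≤-refl

    height-≤-reach : ∀ {W u} → Free W u → ∀ m {r l} → Reach W l u r → height W u m r ≤ l
    height-≤-reach fu zero p = z≤n
    height-≤-reach {W} {u} fu (suc m) {r} {l} p with reach? W m u r
    ... | yes _ = height-≤-reach fu m p
    ... | no ¬q = ≰⇒> λ l≤m → ¬q (reach-mono fu l≤m p)

    reach-height : ∀ {W u} m r → height W u m r ≡ m ⊎ Reach W (height W u m r) u r
    reach-height zero r = inj₁ refl
    reach-height {W} {u} (suc m) r with reach? W m u r
    ... | no  _ = inj₁ refl
    ... | yes q with reach-height {W} {u} m r
    ...   | inj₁ eq = inj₂ (subst (λ k → Reach W k u r) (sym eq) q)
    ...   | inj₂ p  = inj₂ p

    -- Where the height at `r` is truncated, the bound `m` suffices; elsewhere a shortest walk to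
    -- `r` extends by one step. This keeps the shadow as slow as the robber.
    height-lipschitz : ∀ {W u} → Free W u → ∀ m {r r′} → Free W r′ → Step G r r′ →
                       height W u m r′ ≤ suc (height W u m r)
    height-lipschitz {W} {u} fu m {r} {r′} fr′ s with reach-height {W} {u} m r
    ... | inj₁ eq = ≤-trans (height-≤ m r′) (≤-trans (≤-reflexive (sym eq)) (n≤1+n _))
    ... | inj₂ p  = height-≤-reach fu m (reach-snoc _ p s fr′)

    -- Indexed by all naturals and constant past the end, which spares bounds on the index.
    path : ∀ {W} m {u v} → Reach W m u v → ℕ → Fin n
    path zero    {v = v} _       _       = v
    path (suc m) {u = u} _       zero    = u
    path (suc m) (_ , _ , _ , p) (suc i) = path m p i

    path-start : ∀ {W} m {u v} (p : Reach W m u v) → path m p 0 ≡ u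
    path-start zero    refl = refl
    path-start (suc m) p    = refl

    path-end : ∀ {W} m {u v} (p : Reach W m u v) → path m p m ≡ v
    path-end zero    p               = refl
    path-end (suc m) (_ , _ , _ , p) = path-end m p

    path-free : ∀ {W} m {u v} → Free W u → (p : Reach W m u v) → ∀ i → Free W (path m p i)
    path-free zero    fu refl             i       = fu
    path-free (suc m) fu p                zero    = fu
    path-free (suc m) fu (_ , fw , _ , p) (suc i) = path-free m fw p i

    path-step : ∀ {W} m {u v} (p : Reach W m u v) → ∀ i → Step G (path m p i) (path m p (suc i))
    path-step zero    p               i       = inj₁ refl
    path-step (suc m) (_ , _ , s , p) zero    = subst (Step G _) (sym (path-start m p)) s
    path-step (suc m) (_ , _ , s , p) (suc i) = path-step m p i

    -- The truncated distance from u maps Free W onto a shortest path from u to v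
    -- and fixes the path, so a cop on the robber's image guards the whole path.
    module ShortestPath {W u v} (u∈W : u ∈ W) (v∈W : v ∈ W) (l : ℕ)
                        (p : Reach W (3 + l) u v) (shortest : ¬ Reach W (2 + l) u v) where
      private
        L = 3 + l

        fu : Free W u
        fu _ = u∈W

      P : ℕ → Fin n
      P = path L p

      h : Fin n → ℕ
      h = height W u L

      reach-P : ∀ d i {j} → Reach W j u (P i) → Reach W (d + j) u (P (d + i))
      reach-P zero    i q = q
      reach-P (suc d) i q =
        reach-snoc _ (reach-P d i q) (path-step L p (d + i)) (path-free L fu p (suc d + i))

      -- A shorter walk to `P i`, continued along the rest of the path, would reach `v` in fewer
      -- than `L` steps, against `shortest`.
      height-P : ∀ {i} → i ≤ L → h (P i) ≡ i
      height-P {i} i≤L = ≤-antisym (height-≤-reach fu L reach-Pi) (≮⇒≥ no-shortcut)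
        where
        reach-Pi : Reach W i u (P i)
        reach-Pi = subst₂ (λ a b → Reach W a u (P b)) (+-identityʳ i) (+-identityʳ i)
                     (reach-P i 0 (sym (path-start L p)))

        no-shortcut : ¬ h (P i) < i
        no-shortcut h<i with reach-height {W} {u} L (P i) | m≤n⇒∃[o]m+o≡n i≤L
        ... | inj₁ eq | _ = <⇒≱ h<i (≤-trans i≤L (≤-reflexive (sym eq)))
        ... | inj₂ q  | d , i+d≡L = shortest (reach-mono fu (s≤s⁻¹ d+h<L) reach-v)
          where
          d+i≡L : d + i ≡ L
          d+i≡L = trans (+-comm d i) i+d≡L
          reach-v : Reach W (d + h (P i)) u v
          reach-v = subst (Reach W _ u) (trans (cong P d+i≡L) (path-end L p)) (reach-P d i q)
          d+h<L : d + h (P i) < L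
          d+h<L = subst (d + h (P i) <_) d+i≡L (+-monoʳ-< d h<i)

      P-injective : ∀ {i j} → i ≤ L → j ≤ L → P i ≡ P j → i ≡ j
      P-injective i≤L j≤L eq = trans (sym (height-P i≤L)) (trans (cong h eq) (height-P j≤L))

      step-P : ∀ {i j} → i ≤ suc j → j ≤ suc i → Step G (P i) (P j)
      step-P {i} {j} i≤1+j j≤1+i with <-cmp i j
      ... | tri≈ _ refl _ = inj₁ refl
      ... | tri< i<j _ _ with ≤-antisym i<j j≤1+i
      ...   | refl = path-step L p i
      step-P {i} {j} i≤1+j j≤1+i | tri> _ _ j<i with ≤-antisym j<i i≤1+j
      ...   | refl = step-sym (path-step L p j)

      record Fixed (x : Fin n) : Set where
        field
          index   : ℕ
          index≤L : index ≤ L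
          at      : x ≡ P index

      shadow-fixed : ∀ {x} → Fixed x → P (h x) ≡ x
      shadow-fixed record { index≤L = i≤L ; at = refl } = cong P (height-P i≤L)

      -- A robber on one of the three vertices coincides with its own shadow, so a cop one step from
      -- the shadow captures it. The cop first goes to `u` and gains on the shadow from there.
      guard-fixed : Connected G → ∀ {x y z} → Triple W x y z → Fixed x → Fixed y → Fixed z →
                    Guardable W
      guard-fixed conn {x} {y} {z} triple fx fy fz =
        x , y , z , triple , λ wins c r f →
          walk {I = Free W} (λ _ _ f′ → f′) zero (conn (c zero) u) c refl f
            λ c′ at _ r′ f′ → chase wins L 0 (≤-reflexive (sym (+-identityʳ L))) c′
              (trans at (sym (path-start L p))) f′ z≤n
        where
        W′ = W - x - y - z

        fixed : ∀ {r} → Free W r → Free W′ r ⊎ P (h r) ≡ r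
        fixed f with free-remove x y z f
        ... | inj₁ f′                 = inj₁ f′
        ... | inj₂ (inj₁ refl)        = inj₂ (shadow-fixed fx)
        ... | inj₂ (inj₂ (inj₁ refl)) = inj₂ (shadow-fixed fy)
        ... | inj₂ (inj₂ (inj₂ refl)) = inj₂ (shadow-fixed fz)

        shadow-step : ∀ {r r′} → Free W r → Free W r′ → Step G r r′ →
                      Step G (P (h r)) (P (h r′))
        shadow-step f f′ s =
          step-P (height-lipschitz fu L f (step-sym s)) (height-lipschitz fu L f′ s)

        shadow-catch : ∀ {r r′} → Free W r → Free W r′ → Step G r r′ →
                       Free W′ r′ ⊎ Step G (P (h r)) r′
        shadow-catch f f′ s with fixed f′
        ... | inj₁ f″ = inj₁ f″
        ... | inj₂ eq = inj₂ (subst (Step G _) eq (shadow-step f f′ s))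

        guard : Guard W W′
        guard = record { shadow = P ∘ h ; follow = shadow-step ; catch = shadow-catch }

        attained : ∀ {k} → Wins k W′ → ∀ (c : Cops G (suc k)) {r} → Free W r →
                   Step G (c zero) (P (h r)) → Win W c r
        attained wins c f s with fixed f
        ... | inj₁ f′ = pursue guard c f s (wins (tail c) _ f′)
        ... | inj₂ eq = capture c zero (subst (Step G _) eq s)

        -- The cop stays between u and the image of the robber, approaching the latter.
        chase : ∀ {k} → Wins k W′ → ∀ d i → L ≤ d + i → ∀ (c : Cops G (suc k)) {r} →
                c zero ≡ P i → Free W r → i ≤ h r → Win W c r
        chase wins d i L≤ c {r} at f i≤h with h r ≤? suc i
        ... | yes h≤ = attained wins c f
                         (subst (λ a → Step G a _) (sym at) (step-P (m≤n⇒m≤1+n i≤h) h≤))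
        -- `d` is fuel: when it runs out, `i` is at least `L`, which no height exceeds.
        chase wins zero i L≤ c {r} at f i≤h | no h≰ =
          contradiction (≤-trans (height-≤ L r) (m≤n⇒m≤1+n L≤)) h≰
        chase wins (suc d) i L≤ c {r} at f i≤h | no h≰ =
          advance c zero (subst (λ a → Step G a _) (sym at) (path-step L p i))
            λ c′ at′ _ r′ s f′ →
              -- The height was at least `i + 2` and drops by at most one, so the cop at `suc i` has
              -- not passed the shadow.
              chase wins d (suc i) (≤-trans L≤ (≤-reflexive (sym (+-suc d i)))) c′ at′ f′
                (s≤s⁻¹ (≤-trans (≰⇒> h≰) (height-lipschitz fu L f (step-sym s))))

      guard-interior : Connected G → ∀ i → 0 < i → i < L → P i ∈ W → Guardable W
      guard-interior conn i 0<i i<L Pi∈W =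
        guard-fixed conn ((u∈W , Pi∈W , v∈W) , u≢Pi , u≢v , Pi≢v)
          (record { index = 0 ; index≤L = z≤n ; at = u≡P0 })
          (record { index = i ; index≤L = <⇒≤ i<L ; at = refl })
          (record { index = L ; index≤L = ≤-refl ; at = v≡PL })
        where
        u≡P0 = sym (path-start L p)
        v≡PL = sym (path-end L p)
        u≢Pi : u ≢ P i
        u≢Pi eq = <⇒≢ 0<i (P-injective z≤n (<⇒≤ i<L) (trans (sym u≡P0) eq))
        u≢v : u ≢ v
        u≢v eq with P-injective z≤n ≤-refl (trans (sym u≡P0) (trans eq v≡PL))
        ... | ()
        Pi≢v : P i ≢ v
        Pi≢v eq = <⇒≢ i<L (P-injective (<⇒≤ i<L) ≤-refl (trans eq v≡PL))

      -- The second edge of the path contains a vertex of W.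
      guard-path : Connected G → Guardable W
      guard-path conn with path-step L p 1
      ... | inj₁ eq with P-injective (s≤s z≤n) (s≤s (s≤s z≤n)) eq
      ...   | ()
      guard-path conn | inj₂ adj
        with edge-covered (path-free L fu p 1) (path-free L fu p 2) adj
      ... | inj₁ ∈W = guard-interior conn 1 (s≤s z≤n) (s≤s (s≤s z≤n)) ∈W
      ... | inj₂ ∈W = guard-interior conn 2 (s≤s z≤n) (s≤s (s≤s (s≤s z≤n))) ∈W

    -- What holds when no guard can be placed.

    Sparse : Subset n → Set
    Sparse W = ∀ {v x y z} → x ∈ W → y ∈ W → z ∈ W → Step G v x → Step G v y → Step G v z →
               x ≡ y ⊎ x ≡ z ⊎ y ≡ z

    -- `W` covers the edges between free vertices, so a walk from `W` meets `W` again within two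
    -- steps. Hence going from 4 = 2 + 2 down to 2 bounds all distances between vertices of `W` in
    -- one component.
    Tight : Subset n → Set
    Tight W = ∀ {u v} → u ∈ W → v ∈ W → Reach W 4 u v → Reach W 2 u v

    guardable-or-sparse : Connected G → ∀ W → Guardable W ⊎ Sparse W
    guardable-or-sparse conn W
      with (any? λ v → any? λ x → any? λ y → any? λ z →
              triple? W x y z ×-dec step? v x ×-dec step? v y ×-dec step? v z)
    ... | yes (v , x , y , z , triple , vx , vy , vz) =
      inj₁ (guard-neighbours conn triple vx vy vz)
    ... | no none = inj₂ λ {v} {x} {y} {z} x∈ y∈ z∈ vx vy vz → coincide x∈ y∈ z∈ vx vy vz
      where
      coincide : ∀ {v x y z} → x ∈ W → y ∈ W → z ∈ W → Step G v x → Step G v y → Step G v z →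
                 x ≡ y ⊎ x ≡ z ⊎ y ≡ z
      coincide {v} {x} {y} {z} x∈ y∈ z∈ vx vy vz with x ≟ y | x ≟ z | y ≟ z
      ... | yes eq | _      | _      = inj₁ eq
      ... | no _   | yes eq | _      = inj₂ (inj₁ eq)
      ... | no _   | no _   | yes eq = inj₂ (inj₂ eq)
      ... | no x≢y | no x≢z | no y≢z =
        contradiction (v , x , y , z , ((x∈ , y∈ , z∈) , x≢y , x≢z , y≢z) , vx , vy , vz) none

    guardable-or-tight : Connected G → ∀ W → Guardable W ⊎ Tight W
    guardable-or-tight conn W
      with (any? λ u → any? λ v →
              u ∈? W ×-dec v ∈? W ×-dec reach? W 4 u v ×-dec ¬? (reach? W 2 u v))
    -- The distance is 3 or 4; the test selects the length for which the walk is shortest.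
    ... | yes (u , v , u∈ , v∈ , p , ¬q) with reach? W 3 u v
    ...   | yes q  = inj₁ (ShortestPath.guard-path u∈ v∈ 0 q ¬q conn)
    ...   | no  ¬r = inj₁ (ShortestPath.guard-path u∈ v∈ 1 p ¬r conn)
    guardable-or-tight conn W | no none = inj₂ near
      where
      near : Tight W
      near {u} {v} u∈ v∈ p with reach? W 2 u v
      ... | yes q = q
      ... | no ¬q = contradiction (u , v , u∈ , v∈ , p , ¬q) none

    -- Any edge leaving `r` towards a free vertex would have an end in `W`, so the robber can only
    -- wait while one cop walks to it.
    immobile : Connected G → ∀ {W k} (c : Cops G (suc k)) {r} → Free W r → r ∉ W →
               (∀ w → w ∈ W → ¬ Step G r w) → Win W c r
    immobile conn {W} c {r} f r∉W isolated =
      walk {I = _≡ r} stuck zero (conn (c zero) r) c refl refl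
        λ { c′ at _ _ refl → capture c′ zero (inj₁ at) }
      where
      stuck : ∀ {s s′} → s ≡ r → Step G s s′ → Free W s′ → s′ ≡ r
      stuck refl (inj₁ eq)  f′ = sym eq
      stuck refl (inj₂ adj) f′ with edge-covered f f′ adj
      ... | inj₁ r∈W  = contradiction r∈W r∉W
      ... | inj₂ s′∈W = contradiction (inj₂ adj) (isolated _ s′∈W)

    nearby-cover : ∀ W r → (∃[ u ] u ∈ W × Step G r u) ⊎ (∀ w → w ∈ W → ¬ Step G r w)
    nearby-cover W r with (any? λ u → u ∈? W ×-dec step? r u)
    ... | yes found = inj₁ found
    ... | no none   = inj₂ λ w w∈W s → none (w , w∈W , s)

    -- Two cops against a sparse and tight set.

    module TwoCops {W} (sparse : Sparse W) (tight : Tight W) {u} (u∈W : u ∈ W) {k : ℕ} where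
      private
        C = Cops G (2 + k)

        fu : Free W u
        fu _ = u∈W

        pattern A = zero
        pattern B = suc zero

      -- One end of the traversed edge lies in `W` and within distance 4 of `u`, hence within 2 by
      -- tightness; the other end is then within 3.
      invariant : ∀ {r r′} → Free W r × Reach W 3 u r → Step G r r′ → Free W r′ →
                  Free W r′ × Reach W 3 u r′
      invariant (f , q) (inj₁ refl) f′ = f , q
      invariant (f , q) (inj₂ adj)  f′ with edge-covered f f′ adj
      ... | inj₁ r∈W  = f′ , reach-snoc 2 (tight u∈W r∈W (reach-weaken fu q)) (inj₂ adj) f′
      ... | inj₂ r′∈W = f′ , reach-weaken fu (tight u∈W r′∈W (reach-snoc 3 q (inj₂ adj) f′))

      midpoint : ∀ {y} → y ∈ W → Reach W 3 u y → ∃[ a ] Step G u a × Step G a y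
      midpoint y∈W q with tight u∈W y∈W (reach-weaken fu q)
      ... | a , _ , ua , _ , _ , ay , refl = a , ua , ay

      -- Cop A can answer every escape from s other than through w.
      Blocks : Fin n → Fin n → Fin n → Set
      Blocks a s w = ∀ y → y ∈ W → Step G s y → y ≡ w ⊎ Step G a y

      -- By sparsity `s` has at most one neighbour `y` in `W` besides `w`. A midpoint between `u`
      -- and `y` serves as `a`; without such a `y`, cop `A` waits on `u`.
      blocker : ∀ {s w} → Free W s → Reach W 3 u s → w ∈ W → Step G s w →
                ∃[ a ] Step G u a × Blocks a s w
      blocker {s} {w} f q w∈W sw with (any? λ y → y ∈? W ×-dec step? s y ×-dec ¬? (y ≟ w))
      ... | no none = u , inj₁ refl , only-w
        where
        only-w : Blocks u s w
        only-w y y∈W sy with y ≟ w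
        ... | yes eq = inj₁ eq
        ... | no y≢w = contradiction (y , y∈W , sy , y≢w) none
      ... | yes (y , y∈W , sy , y≢w)
        with midpoint y∈W (proj₂ (invariant (f , q) sy (λ _ → y∈W)))
      ... | a , ua , ay = a , ua , only-y
        where
        only-y : Blocks a s w
        only-y x x∈W sx with sparse x∈W w∈W y∈W sx sw sy
        ... | inj₁ eq          = inj₁ eq
        ... | inj₂ (inj₁ refl) = inj₂ ay
        ... | inj₂ (inj₂ w≡y)  = contradiction (sym w≡y) y≢w

      -- From `s` outside `W` every real move enters `W`. Cop `B` on `w` punishes waiting and moving
      -- to `w`, cop `A` on `a` every other move.
      trap : ∀ {s w a} (c : C) → Free W s → s ∉ W → Step G s w →
             Step G (c A) a → Blocks a s w → Step G (c B) w → Win W c s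
      trap {s} {w} {a} c f s∉W sw ca blocks cb =
        move c′ (λ { A → ca ; B → cb ; (suc (suc i)) → inj₁ refl }) (inj₂ respond)
        where
        c′ : C
        c′ = a ◂ (w ◂ tail (tail c))
        respond : ∀ r → Step G s r → Free W r → Win W c′ r
        respond r (inj₁ refl) f′ = capture c′ B (step-sym sw)
        respond r (inj₂ adj)  f′ with edge-covered f f′ adj
        ... | inj₁ s∈W = contradiction s∈W s∉W
        ... | inj₂ r∈W with blocks r r∈W (inj₂ adj)
        ...   | inj₁ eq = capture c′ B (inj₁ (sym eq))
        ...   | inj₂ ar = capture c′ A ar

      close-in : ∀ {s w} (c : C) → c A ≡ u → Step G (c B) w → w ∈ W → Free W s → Reach W 3 u s →
                 s ∉ W → Step G s w → Win W c s
      close-in c refl bw w∈W f q s∉W sw with blocker f q w∈W sw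
      ... | a , ua , blocks = trap c f s∉W sw ua blocks bw

      -- Cop `B` moves next to `w`, which forces the robber to leave. Once it is outside `W` beside
      -- a vertex of `W` that `B` can enter, `close-in` ends the game.
      win-at-cover : ∀ {w} (c : C) → c A ≡ u → c B ≡ u → w ∈ W → Reach W 3 u w → Win W c w
      win-at-cover {w} c atA atB w∈W q with midpoint w∈W q
      ... | b , ub , bw = advance c B (subst (λ x → Step G x b) (sym atB) ub)
          λ c′ at′ same r s f → respond c′ (trans (same A λ ()) atA) (adjacent at′) r s f (r ≟ w) (r ∈? W)
        where
        fw : Free W w
        fw _ = w∈W

        adjacent : ∀ {x} → x ≡ b → Step G x w
        adjacent refl = bw

        respond : ∀ (c : C) → c A ≡ u → Step G (c B) w → ∀ r → Step G w r → Free W r →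
                  Dec (r ≡ w) → Dec (r ∈ W) → Win W c r
        respond c atA cb r wr f (yes refl) _         = capture c B cb
        respond c atA cb r wr f (no r≢w)   (no r∉W)  =
          close-in c atA cb w∈W f (proj₂ (invariant (fw , q) wr f)) r∉W (step-sym wr)
        respond c atA cb r wr f (no r≢w)   (yes r∈W) =
          -- Cop `B` takes the vertex `w` just left. Around `r` the set `W` has only `r` and `w`, so
          -- the robber must now leave `W` or be captured.
          advance c B cb λ c′ at′ same r′ s′ f′ →
            finish c′ (trans (same A λ ()) atA) at′ r′ s′ f′ (r′ ∈? W)
          where
          finish : ∀ (c : C) → c A ≡ u → c B ≡ w → ∀ r′ → Step G r r′ → Free W r′ →
                   Dec (r′ ∈ W) → Win W c r′
          finish c atA atB r′ s f′ (no r′∉W) =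
            -- The vertex `r` just left now plays the role of `w`; it is one step from `B`.
            close-in c atA (subst (λ x → Step G x r) (sym atB) wr) r∈W f′
              (proj₂ (invariant (invariant (fw , q) wr f) s f′)) r′∉W (step-sym s)
          finish c atA atB r′ s f′ (yes r′∈W)
            with sparse r∈W w∈W r′∈W (inj₁ refl) (step-sym wr) s
          ... | inj₁ r≡w         = contradiction r≡w r≢w
          ... | inj₂ (inj₁ refl) = capture c B (subst (λ x → Step G x r) (sym atB) wr)
          ... | inj₂ (inj₂ refl) = capture c B (inj₁ atB)

      -- Cop `A` blocks all escapes except `y`, while `B` moves next to `y`. If the robber waits,
      -- `B` enters `y` and the trap closes.
      win-off-cover : ∀ {s y} (c : C) → c A ≡ u → c B ≡ u → Free W s → s ∉ W → Reach W 3 u s →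
                      y ∈ W → Step G s y → Win W c s
      win-off-cover {s} {y} c atA atB f s∉W q y∈W sy
        with blocker f q y∈W sy | midpoint y∈W (proj₂ (invariant (f , q) sy (λ _ → y∈W)))
      ... | a , ua , blocks | b , ub , by =
        move c′
          (λ { A → subst (λ x → Step G x a) (sym atA) ua
             ; B → subst (λ x → Step G x b) (sym atB) ub
             ; (suc (suc i)) → inj₁ refl })
          (inj₂ respond)
        where
        c′ : C
        c′ = a ◂ (b ◂ tail (tail c))
        respond : ∀ r → Step G s r → Free W r → Win W c′ r
        respond r (inj₁ refl) f′ = trap c′ f s∉W sy (inj₁ refl) blocks by
        respond r (inj₂ adj)  f′ with edge-covered f f′ adj
        ... | inj₁ s∈W = contradiction s∈W s∉W
        ... | inj₂ r∈W with blocks r r∈W (inj₂ adj)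
        ...   | inj₁ refl = capture c′ B by
        ...   | inj₂ ar   = capture c′ A ar

      win-from : Connected G → ∀ {r} (c : C) → c A ≡ u → c B ≡ u → Free W r → Reach W 3 u r →
                 Win W c r
      win-from conn {r} c atA atB f q with r ∈? W | nearby-cover W r
      ... | yes r∈W | _                   = win-at-cover c atA atB r∈W q
      ... | no  r∉W | inj₁ (y , y∈W , ry) = win-off-cover c atA atB f r∉W q y∈W ry
      ... | no  r∉W | inj₂ isolated       = immobile conn c f r∉W isolated

      two-cops-win : Connected G → ∀ {r} (c : C) → Free W r → Reach W 3 u r → Win W c r
      two-cops-win conn c f q =
        walk invariant A (conn (c A) u) c refl (f , q) λ c₁ at₁ _ r₁ I₁ →
          walk invariant B (conn (c₁ B) u) c₁ refl I₁ λ c₂ at₂ same₂ r₂ I₂ →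
            win-from conn c₂ (trans (same₂ A λ ()) at₁) at₂ (proj₁ I₂) (proj₂ I₂)

    -- Induction on the number of unprotected cover vertices.

    spend-guard : ∀ {k W} → (∀ W′ → ∣ W′ ∣ ≤ k * 3 → Wins (suc k) W′) → ∣ W ∣ ≤ suc k * 3 →
                  Guardable W → Wins (2 + k) W
    spend-guard win ∣W∣≤ (x , y , z , triple , guard) =
      guard (win _ (+-cancelˡ-≤ 3 _ _ (≤-trans (∣remove-triple∣ triple) ∣W∣≤)))

    wins : Connected G → ∀ k W → ∣ W ∣ ≤ k * 3 → Wins (suc k) W
    wins conn k W ∣W∣≤ c r f with nearby-cover W r
    -- One cop is enough here; for `k` zero `W` is empty and this is the only possible case.
    ... | inj₂ isolated = immobile conn c f (λ r∈W → isolated r r∈W (inj₁ refl)) isolated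
    wins conn zero W ∣W∣≤ c r f | inj₁ (u , u∈W , _) =
      contradiction (<-≤-trans (x∈p⇒∣p-x∣<∣p∣ u∈W) ∣W∣≤) λ ()
    wins conn (suc k) W ∣W∣≤ c r f | inj₁ (u , u∈W , ru)
      with guardable-or-sparse conn W | guardable-or-tight conn W
    ... | inj₁ guardable | _              = spend-guard (wins conn k) ∣W∣≤ guardable c r f
    ... | inj₂ _         | inj₁ guardable = spend-guard (wins conn k) ∣W∣≤ guardable c r f
    ... | inj₂ sparse | inj₂ tight =
      TwoCops.two-cops-win sparse tight u∈W conn c f
        -- The robber is one step from `u`; two waits give the bound 3 of the invariant.
        (reach-weaken fu (reach-weaken fu (r , f , step-sym ru , refl)))
      where
      fu : Free W u
      fu _ = u∈W

    -- From won positions to a strategy.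

    module Extract {k} (c₀ : Cops G k) (win₀ : ∀ r → Win U c₀ r) where

      -- `nothing` stands for plays that are over or in which the robber moved illegally.
      Plan : Set
      Plan = ∃[ c ] (∀ r → Maybe (Win U {k} c r))

      resume : ∀ {c r} → (∀ r′ → Step G r r′ → Free U r′ → Win U {k} c r′) →
               ∀ r′ → Dec (Step G r r′) → Maybe (Win U c r′)
      resume win r′ (yes s) = just (win r′ s id)
      resume win r′ (no _)  = nothing

      resume-just : ∀ {c r} (win : ∀ r′ → Step G r r′ → Free U r′ → Win U {k} c r′) {r′} →
                    Step G r r′ → ∃[ s ] resume win r′ (step? r r′) ≡ just (win r′ s id)
      resume-just {r = r} win {r′} s with step? r r′
      ... | yes s′ = s′ , refl
      ... | no  ¬s = contradiction s ¬s

      answer : ∀ {c r} → Maybe (Win U {k} c r) → Plan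
      -- A strategy must answer every list, so the cops stay put once no win is pending.
      answer {c}         nothing                        = c , λ _ → nothing
      answer {c}         (just (move c′ _ (inj₁ _)))    = c′ , λ _ → nothing
      answer {c} {r = r} (just (move c′ _ (inj₂ win)))  = c′ , λ r′ → resume win r′ (step? r r′)

      answer-legal : ∀ {c r} (w : Maybe (Win U {k} c r)) i → Step G (c i) (proj₁ (answer w) i)
      answer-legal nothing                          i = inj₁ refl
      answer-legal (just (move _ legal (inj₁ _)))   i = legal i
      answer-legal (just (move _ legal (inj₂ _)))   i = legal i

      plan : List (Fin n) → Plan
      plan []      = c₀ , λ r → just (win₀ r)
      plan (r ∷ h) = answer (proj₂ (plan h) r)

      strategy : Strategy G k
      strategy = record
        { cops  = proj₁ ∘ plan
        ; legal = λ r h → answer-legal (proj₂ (plan h) r)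
        }

      module _ (play : RobberPlay G) where
        open RobberPlay play

        plan-next : ∀ {t c F} {w : Maybe (Win U c (ρ t))} → plan (history t) ≡ (c , F) →
                    F (ρ t) ≡ w → plan (history (suc t)) ≡ answer w
        plan-next {t} now pending =
          trans (cong (λ p → answer (proj₂ p (ρ t))) now) (cong answer pending)

        -- By recursion on the win, the plan along the actual play always holds a smaller pending
        -- win, until a capture.
        captured : ∀ t {c F} (w : Win U c (ρ t)) → plan (history t) ≡ (c , F) →
                   F (ρ t) ≡ just w → ∃[ t′ ] CapturedAt G strategy play t′
        captured t (move c′ _ (inj₁ (i , here))) now pending =
          t , i , inj₂ (trans (cong (λ p → proj₁ p i) (plan-next now pending)) here)
        captured t (move c′ _ (inj₂ win)) now pending
          -- The step found by `step?` may differ from `legal t`, so the recursion continues with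
          -- the former.
          with resume-just win (legal t)
        ... | s , resumed =
          captured (suc t) (win _ s id) (plan-next now pending) resumed

      winning : Winning G strategy
      winning play = captured play 0 (win₀ _) refl refl

theorem1 : ∀ (n : ℕ) (G : SimpleGraph n) → Connected G →
    ∀ (vcn c : ℕ) → IsVertexCoverNumber G vcn → IsCopNumber G c →
    c ≤ ⌈ vcn /3⌉ + 1
theorem1 zero G conn vcn c _ (_ , least) = ≤-trans (least 0 copwin) z≤n
  where
  -- Without vertices the robber cannot be placed, so zero cops win vacuously.
  copwin : CopWin G 0
  copwin = record { cops = λ _ () ; legal = λ _ _ () } , λ play → absurd (RobberPlay.ρ play 0)
    where
    absurd : ∀ {A : Set} → Fin 0 → A
    absurd ()
theorem1 n@(suc _) G conn vcn c ((U , cover , refl) , _) (_ , least) =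
  ≤-trans (least (suc k) (strategy , winning)) (≤-reflexive (+-comm 1 k))
  where
  open CoverGame G U cover
  k = ⌈ ∣ U ∣ /3⌉

  ∣U∣≤k*3 : ∣ U ∣ ≤ k * 3
  -- The 2 added for rounding up absorbs the remainder modulo 3.
  ∣U∣≤k*3 = +-cancelʳ-≤ 2 _ _ (begin
    ∣ U ∣ + 2                       ≡⟨ m≡m%n+[m/n]*n (∣ U ∣ + 2) 3 ⟩
    (∣ U ∣ + 2) % 3 + k * 3         ≤⟨ +-monoˡ-≤ (k * 3) (s≤s⁻¹ (m%n<n (∣ U ∣ + 2) 3)) ⟩
    2 + k * 3                       ≡⟨ +-comm 2 (k * 3) ⟩
    k * 3 + 2                       ∎)
    where open ≤-Reasoning

  -- With `W` equal to `U` every vertex is free, so the robber is unrestricted and `id` proves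
  -- freeness.
  open Extract {suc k} (const zero) (λ r → wins conn k U ∣U∣≤k*3 _ r id)
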